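{- For all positive integers $m,n$ with $mn>1$, the cells of an $m\times n$ matrix can be assigned the distinct integers $1,\ldots,mn$ (each used exactly once) such that the $m$ row sums and the $n$ column sums are $m+n$ pairwise distinct numbers. -}

module Defs where

open import Algebra.Properties.CommutativeMonoid.Sum using (sum)
open import Data.Fin using (Fin; toℕ)
open import Data.Nat using (ℕ; suc; _*_)
open import Data.Nat.Properties using (+-0-commutativeMonoid)
open import Data.Product using (_×_; _,_)
open import Data.Sum using (_⊎_; inj₁; inj₂)
open import Data.Vec.Functional using (Vector)
open import Function.Bundles using (_⤖_; module Bijection)

Matrix : ℕ → ℕ → Set
Matrix m n = Vector (Vector ℕ n) m

-- Using each of 1, …, m * n exactly once amounts to a bijection from the
-- cells onto Fin (m * n) = {0, …, m * n - 1}; entries are shifted by one.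
Assignment : ℕ → ℕ → Set
Assignment m n = (Fin m × Fin n) ⤖ Fin (m * n)

entries : ∀ {m n} → Assignment m n → Matrix m n
entries f i j = suc (toℕ (Bijection.to f (i , j)))

rowSum : ∀ {m n} → Matrix m n → Fin m → ℕ
rowSum A i = sum +-0-commutativeMonoid (λ j → A i j)

colSum : ∀ {m n} → Matrix m n → Fin n → ℕ
colSum A j = sum +-0-commutativeMonoid (λ i → A i j)

-- The family of all m + n line sums, so that its injectivity also separates
-- every row sum from every column sum.
lineSum : ∀ {m n} → Matrix m n → Fin m ⊎ Fin n → ℕ
lineSum A (inj₁ i) = rowSum A i
lineSum A (inj₂ j) = colSum A j

{-# OPTIONS --safe #-}
-- Fill the matrix row by row, with m ≤ n without loss of generality.  Row sums
-- then increase in steps of n², column sums in steps of m, and the column sums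
-- span only m(n - 1) < n², so at most one row sum R_r equals a column sum; r is
-- not the last row, whose sum exceeds every column sum.  In case of a collision,
-- rotate three consecutive values so that row r skips one of them:
--   row r      …, v-2, v, v+1
--   row r+1    v-1, v+2, …
-- Rows and columns stay sorted.  R_r grows by 2, R_{r+1} drops by 2, the first
-- column sum drops by 2, and the last two column sums grow by 1.  This removes
-- the collision and creates no new one if m ≥ 3 and n ≥ 4.  For m = 2 and n ≥ 6
-- there is no collision to begin with, and the remaining sizes are computed.
module Submission where

open import Defs
open import Algebra.Properties.CommutativeMonoid.Sum using (sum)
open import Data.Empty using (⊥-elim)
open import Data.Fin as Fin using (Fin; zero; suc; toℕ; fromℕ<; combine)
open import Data.Fin.Permutation using (Permutation′; permutation; _⟨$⟩ʳ_; cast-id)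
import Data.Fin.Permutation as Perm
import Data.Fin.Properties as Finₚ
open import Data.Nat using (ℕ; zero; suc; _+_; _*_; _≤_; _<_; _≟_; _≤?_; z≤n; s≤s; z<s; s<s; s≤s⁻¹)
open import Data.Nat.Properties
open import Data.Nat.Tactic.RingSolver using (solve-∀)
open import Data.Product using (Σ-syntax; _,_)
open import Data.Product.Algebra using (×-comm)
open import Data.Sum using (inj₁; inj₂; swap)
open import Data.Sum.Properties using (swap-involutive)
open import Function using (_∘_; id)
open import Function.Bundles using (module Bijection)
open import Function.Construct.Composition using (_↔-∘_; _⤖-∘_)
open import Function.Definitions using (Injective)
open import Function.Properties.Inverse using (↔⇒⤖; ↔-sym)
open import Relation.Binary.Definitions using (tri<; tri≈; tri>)
open import Relation.Binary.PropositionalEquality using (_≡_; _≢_; refl; sym; trans; cong; subst; subst₂)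
open import Relation.Nullary using (Dec; yes; no; ¬?)
open import Relation.Nullary.Decidable using (from-yes)
open import Algebra.Properties.CommutativeSemigroup +-commutativeSemigroup using (interchange; x∙yz≈y∙xz)
open import Algebra.Properties.CommutativeMonoid.Sum +-0-commutativeMonoid using (sum-cong-≗)

private
  variable
    m n a b p : ℕ

  ∑ : (Fin n → ℕ) → ℕ
  ∑ = sum +-0-commutativeMonoid

∑-+-mono-≤ : ∀ {n} (f g : Fin n → ℕ) → (∀ k → a + f k ≤ b + g k) → n * a + ∑ f ≤ n * b + ∑ g
∑-+-mono-≤ {n = zero} f g h = z≤n
∑-+-mono-≤ {a} {b} {suc n} f g h =
  subst₂ _≤_ (interchange a (f zero) (n * a) _) (interchange b (g zero) (n * b) _)
    (+-mono-≤ (h zero) (∑-+-mono-≤ (f ∘ suc) (g ∘ suc) (h ∘ suc)))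

∑-mono-≤ : ∀ {n} (f g : Fin n → ℕ) → (∀ k → f k ≤ g k) → ∑ f ≤ ∑ g
∑-mono-≤ {zero} f g h = z≤n
∑-mono-≤ {suc n} f g h = +-mono-≤ (h zero) (∑-mono-≤ (f ∘ suc) (g ∘ suc) (h ∘ suc))

∑-mono-≤-at : ∀ {n} (f g : Fin n → ℕ) k → a + f k ≤ b + g k → (∀ i → i ≢ k → f i ≤ g i) → a + ∑ f ≤ b + ∑ g
∑-mono-≤-at {a} {b} f g zero hk h =
  subst₂ _≤_ (+-assoc a _ _) (+-assoc b _ _)
    (+-mono-≤ hk (∑-mono-≤ (f ∘ suc) (g ∘ suc) (λ i → h (suc i) λ ())))
∑-mono-≤-at {a} {b} f g (suc k) hk h =
  subst₂ _≤_ (x∙yz≈y∙xz (f zero) a _) (x∙yz≈y∙xz (g zero) b _)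
    (+-mono-≤ (h zero λ ()) (∑-mono-≤-at (f ∘ suc) (g ∘ suc) k hk (λ i i≢k → h (suc i) (i≢k ∘ Finₚ.suc-injective))))

∑-const : ∀ n c → ∑ {n} (λ _ → c) ≡ n * c
∑-const zero c = refl
∑-const (suc n) c = cong (c +_) (∑-const n c)

∑-mono-< : (f g : Fin (suc n) → ℕ) → (∀ k → f k < g k) → ∑ f < ∑ g
∑-mono-< f g h = ∑-mono-≤-at f g zero (h zero) (λ i _ → <⇒≤ (h i))

lineSum-injective : (A : Matrix (suc m) (suc n)) →
  (∀ {i i′} j → i Fin.< i′ → A i j < A i′ j) →
  (∀ i {j j′} → j Fin.< j′ → A i j < A i j′) →
  (∀ i j → rowSum A i ≢ colSum A j) →
  Injective _≡_ _≡_ (lineSum A)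
lineSum-injective A rows cols sep {inj₁ i} {inj₁ i′} eq with Finₚ.<-cmp i i′
... | tri< lt _ _ = ⊥-elim (<⇒≢ (∑-mono-< (A i) (A i′) λ j → rows j lt) eq)
... | tri≈ _ e _ = cong inj₁ e
... | tri> _ _ gt = ⊥-elim (<⇒≢ (∑-mono-< (A i′) (A i) λ j → rows j gt) (sym eq))
lineSum-injective A rows cols sep {inj₁ i} {inj₂ j} eq = ⊥-elim (sep i j eq)
lineSum-injective A rows cols sep {inj₂ j} {inj₁ i} eq = ⊥-elim (sep i j (sym eq))
lineSum-injective A rows cols sep {inj₂ j} {inj₂ j′} eq with Finₚ.<-cmp j j′
... | tri< lt _ _ = ⊥-elim (<⇒≢ (∑-mono-< (λ i → A i j) (λ i → A i j′) λ i → cols i lt) eq)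
... | tri≈ _ e _ = cong inj₂ e
... | tri> _ _ gt = ⊥-elim (<⇒≢ (∑-mono-< (λ i → A i j′) (λ i → A i j) λ i → cols i gt) (sym eq))

Antimagic : ℕ → ℕ → Set
Antimagic m n = Σ[ f ∈ Assignment m n ] Injective _≡_ _≡_ (lineSum (entries f))

antimagic-transpose : Antimagic m n → Antimagic n m
antimagic-transpose {m} {n} (f , inj) = g , λ {s} {t} eq →
  swap-injective s t (inj (trans (sym (lines s)) (trans eq (lines t))))
  where
  g : Assignment n m
  g = ↔⇒⤖ (cast-id (*-comm m n)) ⤖-∘ (f ⤖-∘ ↔⇒⤖ (×-comm (Fin n) (Fin m)))

  entry : ∀ i j → entries g i j ≡ entries f j i
  entry i j = cong suc (Finₚ.toℕ-cast (*-comm m n) (Bijection.to f (j , i)))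

  lines : ∀ s → lineSum (entries g) s ≡ lineSum (entries f) (swap s)
  lines (inj₁ i) = sum-cong-≗ (entry i)
  lines (inj₂ j) = sum-cong-≗ (λ i → entry i j)

  swap-injective : ∀ s t → swap s ≡ swap t → s ≡ t
  swap-injective s t eq = trans (sym (swap-involutive s)) (trans (cong swap eq) (swap-involutive t))

layout : (ℕ → ℕ) → ∀ m n → Matrix m n
layout σ m n i j = suc (σ (n * toℕ i + toℕ j))

antimagic-layout : ∀ {σ} (π : Permutation′ (m * n)) → (∀ x → toℕ (π ⟨$⟩ʳ x) ≡ σ (toℕ x)) →
  Injective _≡_ _≡_ (lineSum (layout σ m n)) → Antimagic m n
antimagic-layout {m} {n} {σ} π π≗σ inj = f , λ {s} {t} eq → inj (trans (sym (lines s)) (trans eq (lines t)))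
  where
  f : Assignment m n
  f = ↔⇒⤖ (π ↔-∘ ↔-sym (Finₚ.*↔× {m} {n}))

  entry : ∀ i j → entries f i j ≡ layout σ m n i j
  entry i j = cong suc (trans (π≗σ (combine i j)) (cong σ (Finₚ.toℕ-combine i j)))

  lines : ∀ s → lineSum (entries f) s ≡ lineSum (layout σ m n) s
  lines (inj₁ i) = sum-cong-≗ (entry i)
  lines (inj₂ j) = sum-cong-≗ (λ i → entry i j)

-- rot p is the cycle p ↦ 1 + p ↦ 2 + p ↦ p.
rot : ℕ → ℕ → ℕ
rot zero 0 = 1
rot zero 1 = 2
rot zero 2 = 0
rot zero (suc (suc (suc x))) = suc (suc (suc x))
rot (suc p) zero = zero
rot (suc p) (suc x) = suc (rot p x)

rot³ : ∀ p x → rot p (rot p (rot p x)) ≡ x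
rot³ zero 0 = refl
rot³ zero 1 = refl
rot³ zero 2 = refl
rot³ zero (suc (suc (suc x))) = refl
rot³ (suc p) zero = refl
rot³ (suc p) (suc x) = cong suc (rot³ p x)

rot-bounded : ∀ p x {N} → 2 + p < N → x < N → rot p x < N
rot-bounded zero 0 p<N x<N = <-trans (s<s z<s) p<N
rot-bounded zero 1 p<N x<N = p<N
rot-bounded zero 2 p<N x<N = <-trans z<s p<N
rot-bounded zero (suc (suc (suc x))) p<N x<N = x<N
rot-bounded (suc p) zero p<N x<N = x<N
rot-bounded (suc p) (suc x) (s≤s p<N) (s≤s x<N) = s≤s (rot-bounded p x p<N x<N)

rot-≤-suc : ∀ p x → rot p x ≤ suc x
rot-≤-suc zero 0 = ≤-refl
rot-≤-suc zero 1 = ≤-refl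
rot-≤-suc zero 2 = z≤n
rot-≤-suc zero (suc (suc (suc x))) = n≤1+n _
rot-≤-suc (suc p) zero = z≤n
rot-≤-suc (suc p) (suc x) = s≤s (rot-≤-suc p x)

≤-2+-rot : ∀ p x → x ≤ 2 + rot p x
≤-2+-rot zero 0 = z≤n
≤-2+-rot zero 1 = s≤s z≤n
≤-2+-rot zero 2 = ≤-refl
≤-2+-rot zero (suc (suc (suc x))) = m≤n+m _ 2
≤-2+-rot (suc p) zero = z≤n
≤-2+-rot (suc p) (suc x) = s≤s (≤-2+-rot p x)

≤-rot : ∀ p x → x ≢ 2 + p → x ≤ rot p x
≤-rot zero 0 x≢ = z≤n
≤-rot zero 1 x≢ = s≤s z≤n
≤-rot zero 2 x≢ = ⊥-elim (x≢ refl)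
≤-rot zero (suc (suc (suc x))) x≢ = ≤-refl
≤-rot (suc p) zero x≢ = z≤n
≤-rot (suc p) (suc x) x≢ = s≤s (≤-rot p x (x≢ ∘ cong suc))

rot-below : ∀ p x → x < p → rot p x ≤ x
rot-below (suc p) zero x<p = z≤n
rot-below (suc p) (suc x) (s≤s x<p) = s≤s (rot-below p x x<p)

rot-above : ∀ p x → 2 + p ≤ x → rot p x ≤ x
rot-above zero 2 p≤x = z≤n
rot-above zero (suc (suc (suc x))) p≤x = ≤-refl
rot-above zero 1 (s≤s ())
rot-above (suc p) (suc x) (s≤s p≤x) = s≤s (rot-above p x p≤x)

rot-mono-< : ∀ p x y → y ≢ 2 + p → x < y → rot p x < rot p y
rot-mono-< zero 0 1 y≢ x<y = s<s z<s
rot-mono-< zero 1 1 y≢ (s≤s ())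
rot-mono-< zero x 2 y≢ x<y = ⊥-elim (y≢ refl)
rot-mono-< zero 0 (suc (suc (suc y))) y≢ x<y = s<s z<s
rot-mono-< zero 1 (suc (suc (suc y))) y≢ x<y = s<s (s<s z<s)
rot-mono-< zero 2 (suc (suc (suc y))) y≢ x<y = z<s
rot-mono-< zero (suc (suc (suc x))) (suc (suc (suc y))) y≢ x<y = x<y
rot-mono-< zero (suc (suc x)) 1 y≢ (s≤s ())
rot-mono-< (suc p) zero (suc y) y≢ x<y = z<s
rot-mono-< (suc p) (suc x) (suc y) y≢ (s≤s x<y) = s≤s (rot-mono-< p x y (y≢ ∘ cong suc) x<y)

rot-mono-<-far : ∀ p x y → 3 + x ≤ y → rot p x < rot p y
rot-mono-<-far p x y 3+x≤y with y ≟ 2 + p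
... | no y≢ = rot-mono-< p x y y≢ (<-trans (n<1+n x) (<-trans (n<1+n _) 3+x≤y))
... | yes refl = <-≤-trans (s≤s (rot-below p x x<p)) (≤-trans x<p (s≤s⁻¹ (s≤s⁻¹ (≤-2+-rot p (2 + p)))))
  where
  x<p : x < p
  x<p = s≤s⁻¹ (s≤s⁻¹ 3+x≤y)

rotation : ∀ {N} → 2 + p < N → Permutation′ N
rotation {p} {N} p<N = permutation to (to ∘ to) to³ to³
  where
  to : Fin N → Fin N
  to x = fromℕ< (rot-bounded p (toℕ x) p<N (Finₚ.toℕ<n x))

  toℕ-to : ∀ x → toℕ (to x) ≡ rot p (toℕ x)
  toℕ-to x = Finₚ.toℕ-fromℕ< _

  to³ : ∀ x → to (to (to x)) ≡ x
  to³ x = Finₚ.toℕ-injective (trans (toℕ-to _)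
    (trans (cong (rot p) (trans (toℕ-to _) (cong (rot p) (toℕ-to x)))) (rot³ p (toℕ x))))

toℕ-rotation : ∀ {N} (p<N : 2 + p < N) x → toℕ (rotation p<N ⟨$⟩ʳ x) ≡ rot p (toℕ x)
toℕ-rotation p<N x = Finₚ.toℕ-fromℕ< _

∑-rot : ∀ a k → ∑ {2 + k} (λ j → a + rot k (toℕ j)) ≡ 2 + ∑ {2 + k} (λ j → a + toℕ j)
∑-rot a zero = lemma a
  where
  lemma : ∀ a → (a + 1) + ((a + 2) + 0) ≡ 2 + ((a + 0) + ((a + 1) + 0))
  lemma = solve-∀
∑-rot a (suc k) = trans
  (cong ((a + 0) +_) (trans (sum-cong-≗ {2 + k} (λ j → +-suc a (rot k (toℕ j)))) (trans (∑-rot (suc a) k)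
    (cong (2 +_) (sum-cong-≗ {2 + k} (λ j → sym (+-suc a (toℕ j))))))))
  (x∙yz≈y∙xz (a + 0) 2 _)

rot-shift : ∀ a p x → rot (a + p) (a + x) ≡ a + rot p x
rot-shift zero p x = refl
rot-shift (suc a) p x = cong suc (rot-shift a p x)

row-step : ∀ n {i i′} j → i < i′ → n + (n * i + j) ≤ n * i′ + j
row-step n {i} {i′} j i<i′ = begin
  n + (n * i + j) ≡⟨ sym (+-assoc n _ j) ⟩
  n + n * i + j   ≡⟨ cong (_+ j) (sym (*-suc n i)) ⟩
  n * suc i + j   ≤⟨ +-monoˡ-≤ j (*-monoʳ-≤ n i<i′) ⟩
  n * i′ + j      ∎
  where open ≤-Reasoning

row-end : ∀ {n i k j} → j < n → i < k → n * i + j < n * k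
row-end {n} {i} {k} {j} j<n i<k = begin-strict
  n * i + j <⟨ +-monoʳ-< (n * i) j<n ⟩
  n * i + n ≡⟨ trans (+-comm _ n) (sym (*-suc n i)) ⟩
  n * suc i ≤⟨ *-monoʳ-≤ n i<k ⟩
  n * k     ∎
  where open ≤-Reasoning

off-first-column : ∀ {n i k j} → 0 < j → j < n → n * i + j ≢ n * k
off-first-column {n} {i} {k} {j} 0<j j<n eq with <-cmp i k
... | tri< i<k _ _ = <⇒≢ (row-end j<n i<k) eq
... | tri≈ _ refl _ = <⇒≢ (m<m+n (n * i) 0<j) (sym eq)
... | tri> _ _ k<i = <⇒≢ (≤-<-trans (*-monoʳ-≤ n (<⇒≤ k<i)) (m<m+n (n * i) 0<j)) (sym eq)

module RowMajor (m n : ℕ) where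

  A : Matrix (suc m) (suc n)
  A = layout id (suc m) (suc n)

  antimagic : (∀ i j → rowSum A i ≢ colSum A j) → Antimagic (suc m) (suc n)
  antimagic = antimagic-layout {σ = id} Perm.id (λ _ → refl) ∘ lineSum-injective A
    (λ j i<i′ → s≤s (≤-trans (s≤s (m≤n+m _ n)) (row-step (suc n) (toℕ j) i<i′)))
    (λ i j<j′ → s≤s (+-monoʳ-< (suc n * toℕ i) j<j′))

  rowSum-step : ∀ {i i′} → i Fin.< i′ → suc n * suc n + rowSum A i ≤ rowSum A i′
  rowSum-step {i} {i′} i<i′ = ≤-trans
    (∑-+-mono-≤ {a = suc n} {b = 0} (A i) (A i′) (λ j → ≤-trans (≤-reflexive (+-suc (suc n) _)) (s≤s (row-step (suc n) (toℕ j) i<i′))))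
    (≤-reflexive (cong (_+ rowSum A i′) (*-zeroʳ (suc n))))

  colSum-mono : ∀ {j j′} → toℕ j ≤ toℕ j′ → colSum A j ≤ colSum A j′
  colSum-mono {j} {j′} j≤j′ = ∑-mono-≤ (λ i → A i j) (λ i → A i j′) (λ i → s≤s (+-monoʳ-≤ _ j≤j′))

  colSum-step : ∀ {j j′} → j Fin.< j′ → suc m + colSum A j ≤ colSum A j′
  colSum-step {j} {j′} j<j′ = subst₂ _≤_ (cong (_+ colSum A j) (*-identityʳ (suc m))) (cong (_+ colSum A j′) (*-zeroʳ (suc m)))
    (∑-+-mono-≤ {a = 1} {b = 0} (λ i → A i j) (λ i → A i j′) (λ i → s≤s (+-monoʳ-< (suc n * toℕ i) j<j′)))

  colSum-spread : ∀ j j′ → colSum A j ≤ suc m * n + colSum A j′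
  colSum-spread j j′ = subst (_≤ suc m * n + colSum A j′) (cong (_+ colSum A j) (*-zeroʳ (suc m)))
    (∑-+-mono-≤ {a = 0} (λ i → A i j) (λ i → A i j′) λ i → begin
      suc (suc n * toℕ i + toℕ j)       ≤⟨ s≤s (+-monoʳ-≤ _ (s≤s⁻¹ (Finₚ.toℕ<n j))) ⟩
      suc (suc n * toℕ i + n)           ≡⟨ +-comm (suc (suc n * toℕ i)) n ⟩
      n + suc (suc n * toℕ i)           ≤⟨ +-monoʳ-≤ n (s≤s (m≤m+n _ _)) ⟩
      n + suc (suc n * toℕ i + toℕ j′)  ∎)
    where open ≤-Reasoning

  colSum<lastRowSum : m ≤ n → 0 < n → ∀ i j → toℕ i ≡ m → colSum A j < rowSum A i
  colSum<lastRowSum m≤n (s≤s _) i j i≡m = begin-strict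
    colSum A j                                  ≤⟨ ∑-mono-≤-at {a = 0} {b = N} (λ i′ → A i′ j) (λ _ → N * t) i at-i off-i ⟩
    N + ∑ {suc m} (λ _ → N * t)                 ≡⟨ cong (N +_) (∑-const (suc m) (N * t)) ⟩
    N + suc m * (N * t)                         ≤⟨ +-monoʳ-≤ N (*-monoˡ-≤ (N * t) (s≤s m≤n)) ⟩
    N + N * (N * t)                             ≡⟨ *-suc N (N * t) ⟨
    N * suc (N * t)                             ≡⟨ ∑-const N (suc (N * t)) ⟨
    ∑ {N} (λ _ → suc (N * t))                   <⟨ ∑-mono-≤-at {a = 1} {b = 0} (λ _ → suc (N * t)) (A i) (suc zero)
                                                     (≤-reflexive (cong suc (+-comm 1 (N * t))))
                                                     (λ j′ _ → s≤s (m≤m+n (N * t) (toℕ j′))) ⟩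
    rowSum A i                                  ∎
    where
    open ≤-Reasoning
    N = suc n
    t = toℕ i

    at-i : suc (N * t + toℕ j) ≤ N + N * t
    at-i = ≤-trans (+-monoʳ-< (N * t) (Finₚ.toℕ<n j)) (≤-reflexive (+-comm (N * t) N))

    off-i : ∀ i′ → i′ ≢ i → A i′ j ≤ N * t
    off-i i′ i′≢i = row-end (Finₚ.toℕ<n j)
      (≤∧≢⇒< (subst (toℕ i′ ≤_) (sym i≡m) (s≤s⁻¹ (Finₚ.toℕ<n i′))) (i′≢i ∘ Finₚ.toℕ-injective))

antimagic-2×≥6 : ∀ k → Antimagic 2 (6 + k)
antimagic-2×≥6 k = antimagic λ i j eq → <⇒≢ (<-≤-trans (≤-<-trans (col≤ j) 3N<row₀) (row₀≤ i)) (sym eq)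
  where
  N = 6 + k
  open RowMajor 1 (5 + k)

  col≤ : ∀ j → colSum A j ≤ N * 3
  col≤ j = begin
    suc (N * 0 + toℕ j) + (suc (N * 1 + toℕ j) + 0) ≤⟨ +-mono-≤ (row-end {N} {0} {1} j<N z<s) (+-monoˡ-≤ 0 (row-end {N} {1} {2} j<N ≤-refl)) ⟩
    N * 1 + (N * 2 + 0)                             ≡⟨ lemma N ⟩
    N * 3                                           ∎
    where
    open ≤-Reasoning
    j<N : toℕ j < N
    j<N = Finₚ.toℕ<n j
    lemma : ∀ N → N * 1 + (N * 2 + 0) ≡ N * 3
    lemma = solve-∀

  3N<row₀ : N * 3 < rowSum A zero
  3N<row₀ = begin-strict
    18 + k * 3                         <⟨ +-monoˡ-≤ (k * 3) (m≤n+m 19 2) ⟩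
    21 + k * 3                         ≡⟨ cong (21 +_) (∑-const k 3) ⟨
    21 + ∑ {k} (λ _ → 3)               ≤⟨ +-monoʳ-≤ 21 (∑-mono-≤ {k} _ _ (λ j → m≤m+n 3 (4 + toℕ j))) ⟩
    21 + ∑ {k} (λ j → 7 + toℕ j)       ≤⟨ ∑-mono-≤ {N} (λ j → suc (toℕ j)) (A zero) (λ j → s≤s (m≤n+m (toℕ j) (N * 0))) ⟩
    rowSum A zero                      ∎
    where open ≤-Reasoning

  row₀≤ : ∀ i → rowSum A zero ≤ rowSum A i
  row₀≤ zero = ≤-refl
  row₀≤ i@(suc _) = ≤-trans (m≤n+m (rowSum A zero) (N * N)) (rowSum-step {zero} {i} z<s)

module Rotated (m n : ℕ) (ρ : Fin (suc m)) (ρ<m : toℕ ρ < m) where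

  N = 3 + n
  r = toℕ ρ
  pivot = N * r + suc n
  open RowMajor m (2 + n) using (A)

  B : Matrix (suc m) N
  B = layout (rot pivot) (suc m) N

  2+pivot : 2 + pivot ≡ N * suc r
  2+pivot = lemma n r
    where
    lemma : ∀ n r → 2 + ((3 + n) * r + suc n) ≡ (3 + n) * suc r
    lemma = solve-∀

  pivot-bounded : 2 + pivot < suc m * N
  pivot-bounded = subst₂ _<_ (sym 2+pivot) (*-comm N (suc m)) (*-monoʳ-< N (s<s ρ<m))

  off-pivot : ∀ i {j} → 0 < j → j < N → N * i + j ≢ 2 + pivot
  off-pivot i 0<j j<N eq = off-first-column {N} {i} {suc r} 0<j j<N (trans eq 2+pivot)

  row<ρ : ∀ {i j} → j < N → i < r → N * i + j < pivot
  row<ρ j<N i<r = <-≤-trans (row-end j<N i<r) (m≤m+n (N * r) (suc n))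

  row>ρ : ∀ {i j} → r < i → 2 + pivot ≤ N * i + j
  row>ρ {i} {j} r<i = ≤-trans (≤-reflexive 2+pivot) (≤-trans (*-monoʳ-≤ N r<i) (m≤m+n (N * i) j))

  antimagic : (∀ i j → rowSum B i ≢ colSum B j) → Antimagic (suc m) N
  antimagic = antimagic-layout {σ = rot pivot} (rotation pivot-bounded) (toℕ-rotation pivot-bounded) ∘ lineSum-injective B
    (λ {i} j i<i′ → s≤s (rot-mono-<-far pivot _ _
      (≤-trans (+-monoˡ-≤ (N * toℕ i + toℕ j) (m≤m+n 3 n)) (row-step N (toℕ j) i<i′))))
    (λ i {j} {j′} j<j′ → s≤s (rot-mono-< pivot _ _
      (off-pivot (toℕ i) (≤-<-trans z≤n j<j′) (Finₚ.toℕ<n j′)) (+-monoʳ-< (N * toℕ i) j<j′)))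

  rowSum-ρ : rowSum B ρ ≡ 2 + rowSum A ρ
  rowSum-ρ = trans (sum-cong-≗ {N} (λ j → cong suc (rot-shift (N * r) (suc n) (toℕ j)))) (∑-rot (suc (N * r)) (suc n))

  rowSum-above-ρ : ∀ i → i Fin.< ρ → rowSum B i ≤ rowSum A i
  rowSum-above-ρ i i<ρ = ∑-mono-≤ (B i) (A i) (λ j → s≤s (rot-below pivot _ (row<ρ (Finₚ.toℕ<n j) i<ρ)))

  rowSum-lower : ∀ i → rowSum A i ≤ 2 + rowSum B i
  rowSum-lower i = ∑-mono-≤-at {a = 0} {b = 2} (A i) (B i) zero (s≤s (≤-2+-rot pivot _)) off-zero
    where
    off-zero : ∀ j → j ≢ zero → A i j ≤ B i j
    off-zero zero j≢0 = ⊥-elim (j≢0 refl)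
    off-zero j@(suc _) _ = s≤s (≤-rot pivot _ (off-pivot (toℕ i) z<s (Finₚ.toℕ<n j)))

  colSum-upper : ∀ j → colSum B j ≤ 1 + colSum A j
  colSum-upper j = ∑-mono-≤-at {a = 0} {b = 1} (λ i → B i j) (λ i → A i j) ρ (s≤s (rot-≤-suc pivot _)) off-ρ
    where
    off-ρ : ∀ i → i ≢ ρ → B i j ≤ A i j
    off-ρ i i≢ρ with Finₚ.<-cmp i ρ
    ... | tri< i<ρ _ _ = s≤s (rot-below pivot _ (row<ρ (Finₚ.toℕ<n j) i<ρ))
    ... | tri≈ _ i≡ρ _ = ⊥-elim (i≢ρ i≡ρ)
    ... | tri> _ _ ρ<i = s≤s (rot-above pivot _ (row>ρ ρ<i))

  colSum-lower-positive : ∀ j → 0 < toℕ j → colSum A j ≤ colSum B j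
  colSum-lower-positive j 0<j = ∑-mono-≤ (λ i → A i j) (λ i → B i j)
    (λ i → s≤s (≤-rot pivot _ (off-pivot (toℕ i) 0<j (Finₚ.toℕ<n j))))

  colSum-lower : ∀ j → colSum A j ≤ 2 + colSum B j
  colSum-lower j = ∑-mono-≤-at {a = 0} {b = 2} (λ i → A i j) (λ i → B i j) ρ⁺ (s≤s (≤-2+-rot pivot _)) off-ρ⁺
    where
    ρ⁺ : Fin (suc m)
    ρ⁺ = fromℕ< (s<s ρ<m)

    toℕ-ρ⁺ : toℕ ρ⁺ ≡ suc r
    toℕ-ρ⁺ = Finₚ.toℕ-fromℕ< (s<s ρ<m)

    off-ρ⁺ : ∀ i → i ≢ ρ⁺ → A i j ≤ B i j
    off-ρ⁺ i i≢ρ⁺ = s≤s (≤-rot pivot _ λ eq → i≢ρ⁺ (Finₚ.toℕ-injective (trans (row≡ (trans eq 2+pivot)) (sym toℕ-ρ⁺))))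
      where
      row≡ : N * toℕ i + toℕ j ≡ N * suc r → toℕ i ≡ suc r
      row≡ eq with toℕ j ≟ 0
      ... | no j≢0 = ⊥-elim (off-first-column {N} {toℕ i} {suc r} (n≢0⇒n>0 j≢0) (Finₚ.toℕ<n j) eq)
      ... | yes j≡0 = *-cancelˡ-≡ (toℕ i) (suc r) N
        (trans (sym (trans (cong (N * toℕ i +_) j≡0) (+-identityʳ _))) eq)

module Collision (m n : ℕ) (m≤n : 3 + m ≤ 4 + n) (ρ : Fin (3 + m)) (ρ<m : toℕ ρ < 2 + m)
  (γ : Fin (4 + n)) (eq : rowSum (RowMajor.A (2 + m) (3 + n)) ρ ≡ colSum (RowMajor.A (2 + m) (3 + n)) γ) where

  open RowMajor (2 + m) (3 + n) using (A; rowSum-step; colSum-mono; colSum-step; colSum-spread)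
  open Rotated (2 + m) (suc n) ρ ρ<m
  open ≤-Reasoning

  row-ρ : ∀ j → rowSum B ρ ≢ colSum B j
  row-ρ j with toℕ j ≤? toℕ γ
  ... | yes j≤γ = >⇒≢ (begin-strict
    colSum B j       ≤⟨ colSum-upper j ⟩
    1 + colSum A j   ≤⟨ s≤s (colSum-mono {j} {γ} j≤γ) ⟩
    1 + colSum A γ   ≡⟨ cong suc eq ⟨
    1 + rowSum A ρ   <⟨ ≤-refl ⟩
    2 + rowSum A ρ   ≡⟨ rowSum-ρ ⟨
    rowSum B ρ       ∎)
  ... | no j≰γ = <⇒≢ (begin-strict
    rowSum B ρ           ≡⟨ rowSum-ρ ⟩
    2 + rowSum A ρ       ≡⟨ cong (2 +_) eq ⟩
    2 + colSum A γ       <⟨ +-monoˡ-≤ (colSum A γ) (m≤m+n 3 m) ⟩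
    3 + m + colSum A γ   ≤⟨ colSum-step {γ} {j} (≰⇒> j≰γ) ⟩
    colSum A j           ≤⟨ colSum-lower-positive j (≤-<-trans z≤n (≰⇒> j≰γ)) ⟩
    colSum B j           ∎)

  row<ρ⇒< : ∀ i j → i Fin.< ρ → rowSum B i < colSum B j
  row<ρ⇒< i j i<ρ = +-cancelˡ-< (2 + N * (3 + n)) _ _ (begin-strict
    2 + N * (3 + n) + rowSum B i     <⟨ +-monoˡ-≤ (rowSum B i) (≤-trans (m≤n+m _ (suc n)) (≤-reflexive (lemma n))) ⟩
    N * N + rowSum B i               ≤⟨ +-monoʳ-≤ (N * N) (rowSum-above-ρ i i<ρ) ⟩
    N * N + rowSum A i               ≤⟨ rowSum-step {i} {ρ} i<ρ ⟩
    rowSum A ρ                       ≡⟨ eq ⟩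
    colSum A γ                       ≤⟨ colSum-spread γ j ⟩
    (3 + m) * (3 + n) + colSum A j   ≤⟨ +-mono-≤ (*-monoˡ-≤ (3 + n) m≤n) (colSum-lower j) ⟩
    N * (3 + n) + (2 + colSum B j)   ≡⟨ swap-2 (N * (3 + n)) (colSum B j) ⟩
    2 + N * (3 + n) + colSum B j     ∎)
    where
    lemma : ∀ n → suc n + (3 + (4 + n) * (3 + n)) ≡ (4 + n) * (4 + n)
    lemma = solve-∀
    swap-2 : ∀ x y → x + (2 + y) ≡ 2 + x + y
    swap-2 = solve-∀

  ρ<row⇒< : ∀ i j → ρ Fin.< i → colSum B j < rowSum B i
  ρ<row⇒< i j ρ<i = +-cancelˡ-< 2 _ _ (begin-strict
    2 + colSum B j                               ≤⟨ +-monoʳ-≤ 2 (colSum-upper j) ⟩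
    3 + colSum A j                               ≤⟨ +-monoʳ-≤ 3 (colSum-spread j γ) ⟩
    3 + ((3 + m) * (3 + n) + colSum A γ)         ≤⟨ +-monoʳ-≤ 3 (+-monoˡ-≤ (colSum A γ) (*-monoˡ-≤ (3 + n) m≤n)) ⟩
    3 + (N * (3 + n) + colSum A γ)               ≡⟨ cong (λ x → 3 + (N * (3 + n) + x)) eq ⟨
    3 + (N * (3 + n) + rowSum A ρ)               <⟨ m≤n+m _ n ⟩
    n + (4 + (N * (3 + n) + rowSum A ρ))         ≡⟨ lemma n (rowSum A ρ) ⟩
    N * N + rowSum A ρ                           ≤⟨ rowSum-step {ρ} {i} ρ<i ⟩
    rowSum A i                                   ≤⟨ rowSum-lower i ⟩
    2 + rowSum B i                               ∎)
    where
    lemma : ∀ n x → n + (4 + ((4 + n) * (3 + n) + x)) ≡ (4 + n) * (4 + n) + x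
    lemma = solve-∀

  separated : ∀ i j → rowSum B i ≢ colSum B j
  separated i j with Finₚ.<-cmp i ρ
  ... | tri< i<ρ _ _ = <⇒≢ (row<ρ⇒< i j i<ρ)
  ... | tri≈ _ refl _ = row-ρ j
  ... | tri> _ _ ρ<i = >⇒≢ (ρ<row⇒< i j ρ<i)

antimagic-≥3×≥4 : ∀ m n → 3 + m ≤ 4 + n → Antimagic (3 + m) (4 + n)
antimagic-≥3×≥4 m n m≤n with Finₚ.any? (λ i → Finₚ.any? (λ j → rowSum A i ≟ colSum A j))
  where open RowMajor (2 + m) (3 + n)
... | no ¬eq = RowMajor.antimagic (2 + m) (3 + n) (λ i j eq → ¬eq (i , j , eq))
... | yes (ρ , γ , eq) = Rotated.antimagic (2 + m) (suc n) ρ ρ<m (Collision.separated m n m≤n ρ ρ<m γ eq)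
  where
  ρ<m : toℕ ρ < 2 + m
  ρ<m = ≤∧≢⇒< (s≤s⁻¹ (Finₚ.toℕ<n ρ)) λ ρ≡m →
    <⇒≢ (RowMajor.colSum<lastRowSum (2 + m) (3 + n) (s≤s⁻¹ m≤n) z<s ρ γ ρ≡m) (sym eq)

separated? : ∀ {m n} (A : Matrix m n) → Dec (∀ i j → rowSum A i ≢ colSum A j)
separated? A = Finₚ.all? λ i → Finₚ.all? λ j → ¬? (rowSum A i ≟ colSum A j)

antimagic-≤ : ∀ m n → suc m ≤ suc n → 1 < suc m * suc n → Antimagic (suc m) (suc n)
antimagic-≤ zero zero m≤n (s≤s ())
antimagic-≤ zero (suc n) m≤n 1<mn = RowMajor.antimagic 0 (suc n) λ where
  zero j eq → <⇒≢ (RowMajor.colSum<lastRowSum 0 (suc n) z≤n z<s zero j refl) (sym eq)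
antimagic-≤ 1 0 (s≤s ()) _
antimagic-≤ 1 1 _ _ = RowMajor.antimagic 1 1 (from-yes (separated? (RowMajor.A 1 1)))
antimagic-≤ 1 2 _ _ = RowMajor.antimagic 1 2 (from-yes (separated? (RowMajor.A 1 2)))
antimagic-≤ 1 3 _ _ = Rotated.antimagic 1 1 zero z<s (from-yes (separated? (Rotated.B 1 1 zero z<s)))
antimagic-≤ 1 4 _ _ = Rotated.antimagic 1 2 zero z<s (from-yes (separated? (Rotated.B 1 2 zero z<s)))
antimagic-≤ 1 (suc (suc (suc (suc (suc k))))) _ _ = antimagic-2×≥6 k
antimagic-≤ (suc (suc m)) 0 (s≤s ()) _
antimagic-≤ (suc (suc m)) 1 (s≤s (s≤s ())) _
antimagic-≤ 2 2 _ _ =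
  Rotated.antimagic 2 0 (suc zero) (s<s z<s) (from-yes (separated? (Rotated.B 2 0 (suc zero) (s<s z<s))))
antimagic-≤ (suc (suc (suc m))) 2 (s≤s (s≤s (s≤s ()))) _
antimagic-≤ (suc (suc m)) (suc (suc (suc n))) m≤n _ = antimagic-≥3×≥4 m n m≤n

lemma5p1 : (m n : ℕ) → 0 < m → 0 < n → 1 < m * n →
    Σ[ f ∈ Assignment m n ] Injective _≡_ _≡_ (lineSum (entries f))
lemma5p1 (suc m) (suc n) _ _ 1<mn with ≤-total (suc m) (suc n)
... | inj₁ m≤n = antimagic-≤ m n m≤n 1<mn
... | inj₂ n≤m = antimagic-transpose (antimagic-≤ n m n≤m (subst (1 <_) (*-comm (suc m) (suc n)) 1<mn))
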